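{- For every integer $n \geq 1$, the Bernoulli number $B_{2n}$ and the Euler numbers $E_{2j}$ satisfy $$B_{2n} = \frac{2n}{2^{2n}(2^{2n}-1)}\,\sum_{j=0}^{n-1} \binom{2n-1}{2j}\, E_{2j}.$$
   Context: The Euler numbers $(E_n)_{n\ge 0}$ and the Bernoulli numbers $(B_n)_{n\ge 0}$ are the unique sequences of numbers satisfying $$\frac{2}{e^x+e^{ -x}} = \sum_{n=0}^{\infty} \frac{E_n}{n!}\,x^n \quad\text{and}\quad \frac{x}{e^x-1} = \sum_{n=0}^{\infty} \frac{B_n}{n!}\,x^n .$$ -}

module Defs where

open import Data.Fin.Base using (toℕ)
import Data.Integer.Base as ℤ
open import Data.Nat.Base as ℕ using (ℕ; zero; suc; _∸_; _!)
import Data.Nat.Properties as ℕ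
open import Data.Product.Base using (∃; _,_)
open import Data.Rational.Base
open import Data.Rational.Properties
open import Function.Base using (_∘_)
open import Relation.Binary.PropositionalEquality
open ≡-Reasoning

open import Algebra.Bundles using (CommutativeRing)
open CommutativeRing +-*-commutativeRing using (semiring)
open import Algebra.Properties.Semiring.Sum semiring public
  using (sum; sum-syntax; sum⁺-syntax; sum-cong-≗)
open import Algebra.Properties.Semiring.Exp semiring using (_^_)

-- Formal power series over ℚ, given by their coefficients.
-- Equality of series is pointwise equality _≗_.
Series : Set
Series = ℕ → ℚ

infixl 6 _⊕_ _⊝_
infixl 7 _⊛_

_⊕_ _⊝_ : Series → Series → Series
(f ⊕ g) n = f n + g n
(f ⊝ g) n = f n - g n

_⊛_ : Series → Series → Series
(f ⊛ g) n = ∑[ i ≤ n ] (f (toℕ i) * g (n ∸ toℕ i))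

const : ℚ → Series
const c zero    = c
const c (suc _) = 0ℚ

X : Series
X 1 = 1ℚ
X _ = 0ℚ

1/n! : ℕ → ℚ
1/n! n = _/_ (ℤ.+ 1) (n !) {{n ℕ.!≢0}}

-- The series ∑ (aₙ / n!) xⁿ.
egf : (ℕ → ℚ) → Series
egf a n = a n * 1/n! n

-- The series of e^(c x).
exp : ℚ → Series
exp c = egf (c ^_)

-- ℚ[[x]] is an integral domain, so for g ≠ 0 this pins down h as the quotient
-- f / g, even when g has no constant term (as for e^x − 1 below).
infix 4 _is_over_
_is_over_ : Series → Series → Series → Set
h is f over g = h ⊛ g ≗ f

IsEuler : (ℕ → ℚ) → Set
IsEuler E = egf E is const (ℤ.+ 2 / 1) over exp 1ℚ ⊕ exp (- 1ℚ)

IsBernoulli : (ℕ → ℚ) → Set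
IsBernoulli B = egf B is X over exp 1ℚ ⊝ const 1ℚ

2^2n[2^2n∸1]≢0 : ∀ n .{{_ : ℕ.NonZero n}} →
                 ℕ.NonZero (2 ℕ.^ (2 ℕ.* n) ℕ.* (2 ℕ.^ (2 ℕ.* n) ∸ 1))
2^2n[2^2n∸1]≢0 n =
  ℕ.m*n≢0 (2 ℕ.^ (2 ℕ.* n)) (2 ℕ.^ (2 ℕ.* n) ∸ 1)
    {{ℕ.m^n≢0 2 (2 ℕ.* n)}}
    {{ℕ.>-nonZero (ℕ.m<n⇒0<n∸m (ℕ.^-monoʳ-< 2 (ℕ.s≤s (ℕ.s≤s ℕ.z≤n))
        (ℕ.>-nonZero⁻¹ (2 ℕ.* n) {{ℕ.m*n≢0 2 n}})))}}

-- Existence of both sequences, so that IsEuler and IsBernoulli are not vacuous.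

private
  tail : Series → Series
  tail f = f ∘ suc

  module _ (g : Series) .{{g₀≢0 : NonZero (g 0)}} where

    quotient : Series → Series
    quotient f zero    = f 0 * 1/ g 0
    quotient f (suc n) =
      quotient (λ k → f (suc k) - (f 0 * 1/ g 0) * g (suc k)) n

    quotient-is : ∀ f → quotient f is f over g
    quotient-is f zero = begin
      f 0 * 1/ g 0 * g 0 + 0ℚ  ≡⟨ +-identityʳ _ ⟩
      f 0 * 1/ g 0 * g 0       ≡⟨ *-assoc (f 0) (1/ g 0) (g 0) ⟩
      f 0 * (1/ g 0 * g 0)     ≡⟨ cong (f 0 *_) (*-inverseˡ (g 0)) ⟩
      f 0 * 1ℚ                 ≡⟨ *-identityʳ (f 0) ⟩
      f 0                      ∎
    quotient-is f (suc n) = begin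
      c + (quotient f′ ⊛ g) n  ≡⟨ cong (c +_) (quotient-is f′ n) ⟩
      c + (f (suc n) - c)      ≡⟨ +-comm c (f (suc n) - c) ⟩
      f (suc n) - c + c        ≡⟨ +-assoc (f (suc n)) (- c) c ⟩
      f (suc n) + (- c + c)    ≡⟨ cong (f (suc n) +_) (+-inverseˡ c) ⟩
      f (suc n) + 0ℚ           ≡⟨ +-identityʳ (f (suc n)) ⟩
      f (suc n)                ∎
      where
      c  = f 0 * 1/ g 0 * g (suc n)
      f′ = λ k → f (suc k) - (f 0 * 1/ g 0) * g (suc k)

  ⊛-shift : ∀ h g → g 0 ≡ 0ℚ → ∀ n → (h ⊛ g) (suc n) ≡ (h ⊛ tail g) n
  ⊛-shift h g g₀≡0 zero = cong (h 0 * g 1 +_) (begin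
    h 1 * g 0 + 0ℚ  ≡⟨ +-identityʳ _ ⟩
    h 1 * g 0       ≡⟨ cong (h 1 *_) g₀≡0 ⟩
    h 1 * 0ℚ        ≡⟨ *-zeroʳ (h 1) ⟩
    0ℚ              ∎)
  ⊛-shift h g g₀≡0 (suc n) =
    cong (h 0 * g (suc (suc n)) +_) (⊛-shift (tail h) g g₀≡0 n)

  ⊛-congˡ : ∀ {h k} g → h ≗ k → h ⊛ g ≗ k ⊛ g
  ⊛-congˡ g h≗k n = sum-cong-≗ {suc n} λ i → cong (_* g (n ∸ toℕ i)) (h≗k (toℕ i))

  -- egf is surjective, with section h ↦ (n! hₙ)ₙ.
  1/n!≢0 : ∀ n → NonZero (1/n! n)
  1/n!≢0 n = pos⇒nonZero (1/n! n) {{normalize-pos 1 (n !) {{n ℕ.!≢0}}}}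

  unegf : Series → ℕ → ℚ
  unegf h n = h n * (1/_ (1/n! n) {{1/n!≢0 n}})

  egf-unegf : ∀ h → egf (unegf h) ≗ h
  egf-unegf h n = begin
    h n * q * 1/n! n    ≡⟨ *-assoc (h n) q (1/n! n) ⟩
    h n * (q * 1/n! n)  ≡⟨ cong (h n *_) (*-inverseˡ (1/n! n) {{1/n!≢0 n}}) ⟩
    h n * 1ℚ            ≡⟨ *-identityʳ (h n) ⟩
    h n                 ∎
    where q = 1/_ (1/n! n) {{1/n!≢0 n}}

euler-exists : ∃ IsEuler
euler-exists = unegf h , λ n →
  trans (⊛-congˡ g (egf-unegf h) n) (quotient-is g (const (ℤ.+ 2 / 1)) n)
  where
  g = exp 1ℚ ⊕ exp (- 1ℚ)
  h = quotient g (const (ℤ.+ 2 / 1))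

bernoulli-exists : ∃ IsBernoulli
bernoulli-exists = unegf h , λ n →
  trans (⊛-congˡ g (egf-unegf h) n) (lemma n)
  where
  g = exp 1ℚ ⊝ const 1ℚ
  h = quotient (tail g) (tail X)
  lemma : h is X over g
  lemma zero    = trans (+-identityʳ _) (*-zeroʳ (h 0))
  lemma (suc n) = trans (⊛-shift h g refl n) (quotient-is (tail g) (tail X) n)

{-# OPTIONS --safe #-}

-- Let b = x / (eˣ − 1) and s = 2 / (eˣ + e⁻ˣ).  Clearing the denominators
-- with (eˣ + e⁻ˣ) eˣ (e²ˣ − 1) = e⁴ˣ − 1 gives
--   x s (eˣ − e⁻ˣ) = 2 (x − b(2x) + b(4x)).
-- The even coefficients of eˣ − e⁻ˣ vanish, so only the E₂ⱼ contribute to the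
-- coefficient of x²ⁿ on the left, while on the right it is
-- 2 (4²ⁿ − 2²ⁿ) B₂ₙ / (2n)!.
module Submission where

open import Defs
open import Algebra.Bundles using (CommutativeRing)
import Algebra.Construct.Pointwise as Pointwise
import Algebra.Solver.Ring as RingSolver
open import Algebra.Solver.Ring.AlmostCommutativeRing
  using (AlmostCommutativeRing; fromCommutativeRing; _-Raw-AlmostCommutative⟶_)
open import Data.Fin.Base using (Fin; toℕ)
import Data.Fin.Properties as Fin
import Data.Integer.Base as ℤ
import Data.Integer.Properties as ℤ
open import Data.Maybe.Base using (map)
open import Data.Nat.Base as ℕ using (ℕ; zero; suc; _∸_; NonZero; _!; _≤_)
open import Data.Nat.Combinatorics using (_C_; nCk≡n!/k![n-k]!; k![n∸k]!∣n!)
open import Data.Nat.DivMod using (m/n*n≡m)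
import Data.Nat.Properties as ℕ
open import Data.Product.Base using (_,_)
open import Data.Rational.Base as ℚ using (ℚ; _+_; _*_; _/_; _-_; -_; 0ℚ; 1ℚ; 1/_; ½)
import Data.Rational.Properties as ℚ
open import Data.Rational.Solver using (module +-*-Solver)
open import Data.Rational.Unnormalised.Base as ℚᵘ using (mkℚᵘ; *≡*)
import Data.Rational.Unnormalised.Properties as ℚᵘ
open import Function.Base using (_∘_)
open import Relation.Binary.PropositionalEquality
open import Relation.Nullary.Decidable using (dec⇒maybe)

open CommutativeRing ℚ.+-*-commutativeRing using (semiring; commutativeSemiring)
import Algebra.Properties.CommutativeSemiring.Binomial commutativeSemiring as Binomial
open import Algebra.Properties.CommutativeSemiring.Exp commutativeSemiring
  using (_^_; ^-homo-*; ^-assocʳ; ^-distrib-*)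
open import Algebra.Properties.Semiring.Mult semiring using (_×_)
open import Algebra.Properties.Semiring.Sum semiring
  using (∑-distrib-+; *-distribˡ-sum; *-distribʳ-sum)
open +-*-Solver using (solve; con; _:=_; _:+_; _:*_; _:-_; :-_)
open ≡-Reasoning

-- The commutative ring of formal power series over ℚ.

-- The sum defining `⊛` unfolds at its first term, so `(f ⊛ g) (suc n)` computes to
-- `f 0 * g (suc n) + (tail f ⊛ g) n`. The inductions on the coefficient index rest on this; a stray
-- `+ 0ℚ` is the empty sum where the unfolding ends.
tail : Series → Series
tail f = f ∘ suc

⊛-cong : ∀ {f f′ g g′} → f ≗ f′ → g ≗ g′ → f ⊛ g ≗ f′ ⊛ g′
⊛-cong f≗f′ g≗g′ n = sum-cong-≗ {suc n} λ i →
  cong₂ _*_ (f≗f′ (toℕ i)) (g≗g′ (n ∸ toℕ i))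

⊛-zeroˡ : ∀ f → (λ _ → 0ℚ) ⊛ f ≗ λ _ → 0ℚ
⊛-zeroˡ f zero    = solve 1 (λ a → con 0ℚ :* a :+ con 0ℚ := con 0ℚ) refl (f 0)
⊛-zeroˡ f (suc n) rewrite ⊛-zeroˡ f n =
  solve 1 (λ a → con 0ℚ :* a :+ con 0ℚ := con 0ℚ) refl (f (suc n))

const-⊛ : ∀ c f n → (const c ⊛ f) n ≡ c * f n
const-⊛ c f zero    = ℚ.+-identityʳ (c * f 0)
const-⊛ c f (suc n) rewrite ⊛-zeroˡ f n = ℚ.+-identityʳ (c * f (suc n))

⊛-distribˡ : ∀ f g h → f ⊛ (g ⊕ h) ≗ f ⊛ g ⊕ f ⊛ h
⊛-distribˡ f g h n = trans
  (sum-cong-≗ {suc n} λ i → ℚ.*-distribˡ-+ (f (toℕ i)) (g (n ∸ toℕ i)) (h (n ∸ toℕ i)))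
  (∑-distrib-+ {suc n} (λ i → f (toℕ i) * g (n ∸ toℕ i)) (λ i → f (toℕ i) * h (n ∸ toℕ i)))

-- Splits off the last term of the convolution instead of the first. This is the recursion in the
-- right factor, the mirror image that `⊛-comm` needs.
⊛-sucʳ : ∀ f g n → (f ⊛ g) (suc n) ≡ (f ⊛ tail g) n + f (suc n) * g 0
⊛-sucʳ f g zero =
  solve 2 (λ a b → a :+ (b :+ con 0ℚ) := a :+ con 0ℚ :+ b) refl (f 0 * g 1) (f 1 * g 0)
⊛-sucʳ f g (suc n) = trans
  (cong (f 0 * g (suc (suc n)) +_) (⊛-sucʳ (tail f) g n))
  (sym (ℚ.+-assoc (f 0 * g (suc (suc n))) ((tail f ⊛ tail g) n) _))

⊛-comm : ∀ f g → f ⊛ g ≗ g ⊛ f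
⊛-comm f g zero    = cong (_+ 0ℚ) (ℚ.*-comm (f 0) (g 0))
⊛-comm f g (suc n) = begin
  f 0 * g (suc n) + (tail f ⊛ g) n  ≡⟨ cong₂ _+_ (ℚ.*-comm (f 0) (g (suc n))) (⊛-comm (tail f) g n) ⟩
  g (suc n) * f 0 + (g ⊛ tail f) n  ≡⟨ ℚ.+-comm (g (suc n) * f 0) ((g ⊛ tail f) n) ⟩
  (g ⊛ tail f) n + g (suc n) * f 0  ≡⟨ ⊛-sucʳ g f n ⟨
  (g ⊛ f) (suc n)                   ∎

⊛-distribʳ : ∀ f g h → (g ⊕ h) ⊛ f ≗ g ⊛ f ⊕ h ⊛ f
⊛-distribʳ f g h n = begin
  ((g ⊕ h) ⊛ f) n            ≡⟨ ⊛-comm (g ⊕ h) f n ⟩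
  (f ⊛ (g ⊕ h)) n            ≡⟨ ⊛-distribˡ f g h n ⟩
  (f ⊛ g) n + (f ⊛ h) n      ≡⟨ cong₂ _+_ (⊛-comm f g n) (⊛-comm f h n) ⟩
  (g ⊛ f) n + (h ⊛ f) n      ∎

⊛-scaleˡ : ∀ c f g n → ((λ k → c * f k) ⊛ g) n ≡ c * (f ⊛ g) n
⊛-scaleˡ c f g n = trans
  (sum-cong-≗ {suc n} λ i → ℚ.*-assoc c (f (toℕ i)) (g (n ∸ toℕ i)))
  (sym (*-distribˡ-sum {suc n} c (λ i → f (toℕ i) * g (n ∸ toℕ i))))

-- Induction on the coefficient index, for all `f` at once: `tail (f ⊛ g)` computes to `f 0` times
-- `tail g` plus `tail f ⊛ g`, and the second summand falls to the induction hypothesis for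
-- `tail f`.
⊛-assoc : ∀ f g h → (f ⊛ g) ⊛ h ≗ f ⊛ (g ⊛ h)
⊛-assoc f g h zero =
  solve 3 (λ a b c → (a :* b :+ con 0ℚ) :* c :+ con 0ℚ := a :* (b :* c :+ con 0ℚ) :+ con 0ℚ)
    refl (f 0) (g 0) (h 0)
⊛-assoc f g h (suc n) = begin
  (f₀ * g 0 + 0ℚ) * h (suc n) + (((λ k → f₀ * tail g k) ⊕ tail f ⊛ g) ⊛ h) n
    ≡⟨ cong ((f₀ * g 0 + 0ℚ) * h (suc n) +_) (⊛-distribʳ h (λ k → f₀ * tail g k) (tail f ⊛ g) n) ⟩
  (f₀ * g 0 + 0ℚ) * h (suc n) + (((λ k → f₀ * tail g k) ⊛ h) n + (tail f ⊛ g ⊛ h) n)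
    ≡⟨ cong ((f₀ * g 0 + 0ℚ) * h (suc n) +_) (cong₂ _+_ (⊛-scaleˡ f₀ (tail g) h n) (⊛-assoc (tail f) g h n)) ⟩
  (f₀ * g 0 + 0ℚ) * h (suc n) + (f₀ * (tail g ⊛ h) n + (tail f ⊛ (g ⊛ h)) n)
    ≡⟨ solve 5 (λ a b c d e → (a :* b :+ con 0ℚ) :* c :+ (a :* d :+ e)
                           := a :* (b :* c :+ d) :+ e)
         refl f₀ (g 0) (h (suc n)) ((tail g ⊛ h) n) ((tail f ⊛ (g ⊛ h)) n) ⟩
  f₀ * (g 0 * h (suc n) + (tail g ⊛ h) n) + (tail f ⊛ (g ⊛ h)) n  ∎
  where f₀ = f 0

⊛-identityˡ : ∀ f → const 1ℚ ⊛ f ≗ f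
⊛-identityˡ f n = trans (const-⊛ 1ℚ f n) (ℚ.*-identityˡ (f n))

seriesRing : CommutativeRing _ _
seriesRing = record
  { Carrier = Series ; _≈_ = _≗_
  ; _+_ = _⊕_ ; _*_ = _⊛_ ; -_ = -_ ∘_ ; 0# = λ _ → 0ℚ ; 1# = const 1ℚ
  ; isCommutativeRing = record
    { isRing = record
      { +-isAbelianGroup = Pointwise.isAbelianGroup ℕ ℚ.+-0-isAbelianGroup
      ; *-cong     = ⊛-cong
      ; *-assoc    = ⊛-assoc
      ; *-identity = ⊛-identityˡ , λ f n → trans (⊛-comm f (const 1ℚ) n) (⊛-identityˡ f n)
      ; distrib    = ⊛-distribˡ , ⊛-distribʳ
      }
    ; *-comm = ⊛-comm
    }
  }

seriesACR : AlmostCommutativeRing _ _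
seriesACR = fromCommutativeRing seriesRing

const-homo : AlmostCommutativeRing.rawRing (fromCommutativeRing ℚ.+-*-commutativeRing)
             -Raw-AlmostCommutative⟶ seriesACR
const-homo = record
  { ⟦_⟧    = const
  ; +-homo = λ { a b zero → refl ; a b (suc n) → refl }
  ; *-homo = λ { a b zero → sym (const-⊛ a (const b) 0)
               ; a b (suc n) → sym (trans (const-⊛ a (const b) (suc n)) (ℚ.*-zeroʳ a)) }
  ; -‿homo = λ { a zero → refl ; a (suc n) → refl }
  ; 0-homo = λ { zero → refl ; (suc n) → refl }
  ; 1-homo = λ _ → refl
  }

-- Coefficients in ℚ rather than in the series ring, where equality is undecidable.
module S = RingSolver _ seriesACR const-homo
  (λ a b → map (λ a≡b n → cong (λ c → const c n) a≡b) (dec⇒maybe (a ℚ.≟ b)))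

-- Cancellation of series.

-- The constant coefficient of the product is `f 0 * g 0`, which forces `f 0 ≡ 0ℚ`. Then
-- `tail f ⊛ g` vanishes as well, and the argument repeats with `tail f` at a smaller index.
⊛-cancelʳ₀ : ∀ g .{{_ : ℚ.NonZero (g 0)}} f → f ⊛ g ≗ (λ _ → 0ℚ) → f ≗ λ _ → 0ℚ
⊛-cancelʳ₀ g f fg≗0 = go
  where
  f₀≡0 : f 0 ≡ 0ℚ
  f₀≡0 = begin
    f 0                           ≡⟨ ℚ.*-identityʳ (f 0) ⟨
    f 0 * 1ℚ                      ≡⟨ cong (f 0 *_) (ℚ.*-inverseʳ (g 0)) ⟨
    f 0 * (g 0 * 1/ g 0)          ≡⟨ solve 3 (λ a b c → a :* (b :* c) := (a :* b :+ con 0ℚ) :* c)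
                                       refl (f 0) (g 0) (1/ g 0) ⟩
    (f 0 * g 0 + 0ℚ) * 1/ g 0     ≡⟨ cong (_* 1/ g 0) (fg≗0 0) ⟩
    0ℚ * 1/ g 0                   ≡⟨ ℚ.*-zeroˡ (1/ g 0) ⟩
    0ℚ                            ∎
  tail-f≗0 : tail f ⊛ g ≗ λ _ → 0ℚ
  tail-f≗0 n = begin
    (tail f ⊛ g) n                        ≡⟨ solve 2 (λ a b → b := con 0ℚ :* a :+ b)
                                               refl (g (suc n)) ((tail f ⊛ g) n) ⟩
    0ℚ * g (suc n) + (tail f ⊛ g) n       ≡⟨ cong (λ z → z * g (suc n) + (tail f ⊛ g) n) f₀≡0 ⟨
    f 0 * g (suc n) + (tail f ⊛ g) n      ≡⟨ fg≗0 (suc n) ⟩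
    0ℚ                                    ∎
  go : f ≗ λ _ → 0ℚ
  go zero    = f₀≡0
  go (suc n) = ⊛-cancelʳ₀ g (tail f) tail-f≗0 n

-- A series `g` of order exactly one is x times `tail g`, and `tail g` has an invertible constant
-- coefficient, so `⊛-cancelʳ₀` applies to `f ⊝ h`. This covers divisors such as e⁴ˣ - 1.
⊛-cancelʳ₁ : ∀ g → g 0 ≡ 0ℚ → .{{_ : ℚ.NonZero (g 1)}} → ∀ f h → f ⊛ g ≗ h ⊛ g → f ≗ h
⊛-cancelʳ₁ g g₀≡0 f h fg≗hg n = begin
  f n                  ≡⟨ solve 2 (λ a b → a := (a :- b) :+ b) refl (f n) (h n) ⟩
  (f n - h n) + h n    ≡⟨ cong (_+ h n) (⊛-cancelʳ₀ (tail g) (f ⊝ h) diff n) ⟩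
  0ℚ + h n             ≡⟨ ℚ.+-identityˡ (h n) ⟩
  h n                  ∎
  where
  diff : (f ⊝ h) ⊛ tail g ≗ λ _ → 0ℚ
  diff k = begin
    ((f ⊝ h) ⊛ tail g) k
      ≡⟨ solve 2 (λ a b → a := a :+ b :* con 0ℚ) refl _ (f (suc k) - h (suc k)) ⟩
    ((f ⊝ h) ⊛ tail g) k + (f (suc k) - h (suc k)) * 0ℚ
      ≡⟨ cong (λ z → ((f ⊝ h) ⊛ tail g) k + (f (suc k) - h (suc k)) * z) g₀≡0 ⟨
    ((f ⊝ h) ⊛ tail g) k + (f (suc k) - h (suc k)) * g 0
      ≡⟨ ⊛-sucʳ (f ⊝ h) g k ⟨
    ((f ⊝ h) ⊛ g) (suc k)
      ≡⟨ S.solve 3 (λ f h g → (f S.:- h) S.:* g S.:= f S.:* g S.:- h S.:* g) (λ _ → refl) f h g (suc k) ⟩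
    (f ⊛ g) (suc k) - (h ⊛ g) (suc k)
      ≡⟨ cong (_- (h ⊛ g) (suc k)) (fg≗hg (suc k)) ⟩
    (h ⊛ g) (suc k) - (h ⊛ g) (suc k)
      ≡⟨ ℚ.+-inverseʳ ((h ⊛ g) (suc k)) ⟩
    0ℚ  ∎

-- Natural numbers, fractions and factorials in ℚ.

-- Fractions in `ℚ` are normalised by a gcd, which blocks computation with variables. Identities
-- between fractions are therefore checked by cross-multiplication in `ℚᵘ` and carried over by
-- `ℚ.fromℚᵘ`.
fromℚᵘ-homo-+ : ∀ p q → ℚ.fromℚᵘ (p ℚᵘ.+ q) ≡ ℚ.fromℚᵘ p + ℚ.fromℚᵘ q
fromℚᵘ-homo-+ p q = ℚ.toℚᵘ-injective (ℚᵘ.≃-trans (ℚ.toℚᵘ-fromℚᵘ (p ℚᵘ.+ q)) (ℚᵘ.≃-sym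
  (ℚᵘ.≃-trans (ℚ.toℚᵘ-homo-+ (ℚ.fromℚᵘ p) (ℚ.fromℚᵘ q))
    (ℚᵘ.+-cong (ℚ.toℚᵘ-fromℚᵘ p) (ℚ.toℚᵘ-fromℚᵘ q)))))

fromℚᵘ-homo-* : ∀ p q → ℚ.fromℚᵘ (p ℚᵘ.* q) ≡ ℚ.fromℚᵘ p * ℚ.fromℚᵘ q
fromℚᵘ-homo-* p q = ℚ.toℚᵘ-injective (ℚᵘ.≃-trans (ℚ.toℚᵘ-fromℚᵘ (p ℚᵘ.* q)) (ℚᵘ.≃-sym
  (ℚᵘ.≃-trans (ℚ.toℚᵘ-homo-* (ℚ.fromℚᵘ p) (ℚ.fromℚᵘ q))
    (ℚᵘ.*-cong (ℚ.toℚᵘ-fromℚᵘ p) (ℚ.toℚᵘ-fromℚᵘ q)))))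

fromℕ : ℕ → ℚ
fromℕ n = ℤ.+ n / 1

fromℕ-+ : ∀ m n → fromℕ (m ℕ.+ n) ≡ fromℕ m + fromℕ n
fromℕ-+ m n = trans
  (ℚ.fromℚᵘ-cong {mkℚᵘ (ℤ.+ (m ℕ.+ n)) 0} {mkℚᵘ (ℤ.+ m) 0 ℚᵘ.+ mkℚᵘ (ℤ.+ n) 0}
    (*≡* (cong (ℤ._* ℤ.1ℤ) (sym (cong₂ ℤ._+_ (ℤ.*-identityʳ (ℤ.+ m)) (ℤ.*-identityʳ (ℤ.+ n)))))))
  (fromℚᵘ-homo-+ (mkℚᵘ (ℤ.+ m) 0) (mkℚᵘ (ℤ.+ n) 0))

fromℕ-* : ∀ m n → fromℕ (m ℕ.* n) ≡ fromℕ m * fromℕ n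
fromℕ-* m n = trans
  (cong (_/ 1) (ℤ.pos-* m n))
  (fromℚᵘ-homo-* (mkℚᵘ (ℤ.+ m) 0) (mkℚᵘ (ℤ.+ n) 0))

/-*-cancel : ∀ m n .{{_ : NonZero n}} → (ℤ.+ m / n) * fromℕ n ≡ fromℕ m
-- `mkℚᵘ` stores the denominator minus one, so `mkℚᵘ (ℤ.+ m) n` is m / (n + 1).
/-*-cancel m (suc n) = trans
  (sym (fromℚᵘ-homo-* (mkℚᵘ (ℤ.+ m) n) (mkℚᵘ (ℤ.+ suc n) 0)))
  (ℚ.fromℚᵘ-cong {mkℚᵘ (ℤ.+ m) n ℚᵘ.* mkℚᵘ (ℤ.+ suc n) 0} {mkℚᵘ (ℤ.+ m) 0}
    (*≡* (trans (ℤ.*-identityʳ _) (cong (λ k → ℤ.+ m ℤ.* ℤ.+ suc k) (sym (ℕ.*-identityʳ n))))))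

-- `Binomial.theorem` has its coefficients as repeated sums `_×_`; this turns them into rational
-- factors.
×≡fromℕ* : ∀ n p → n × p ≡ fromℕ n * p
×≡fromℕ* zero    p = sym (ℚ.*-zeroˡ p)
×≡fromℕ* (suc n) p = begin
  p + n × p                ≡⟨ cong (p +_) (×≡fromℕ* n p) ⟩
  p + fromℕ n * p          ≡⟨ solve 2 (λ p n → p :+ n :* p := (con 1ℚ :+ n) :* p) refl p (fromℕ n) ⟩
  (1ℚ + fromℕ n) * p       ≡⟨ cong (_* p) (fromℕ-+ 1 n) ⟨
  fromℕ (suc n) * p        ∎

fromℕ-^ : ∀ m n → fromℕ (m ℕ.^ n) ≡ fromℕ m ^ n
fromℕ-^ m zero    = refl
fromℕ-^ m (suc n) = trans (fromℕ-* m (m ℕ.^ n)) (cong (fromℕ m *_) (fromℕ-^ m n))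

1/n!*n! : ∀ n → 1/n! n * fromℕ (n !) ≡ 1ℚ
1/n!*n! n = /-*-cancel 1 (n !) {{ℕ._!≢0 n}}

-- The factorial formula for `n C k`, divided by n!. In this form it converts products of
-- exponential coefficients into binomial sums, both for `exp-+` and for the Euler sum.
nCk/n! : ∀ {n k} → k ≤ n → fromℕ (n C k) * 1/n! n ≡ 1/n! k * 1/n! (n ∸ k)
nCk/n! {n} {k} k≤n = begin
  c * 1/n! n
    ≡⟨ solve 2 (λ c r → c :* r := con 1ℚ :* con 1ℚ :* (c :* r)) refl c (1/n! n) ⟩
  1ℚ * 1ℚ * (c * 1/n! n)
    ≡⟨ cong₂ (λ a b → a * b * (c * 1/n! n)) (1/n!*n! k) (1/n!*n! l) ⟨
  -- The two units become k!/k! and l!/l!, so that the factorials can meet `c` and give n!.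
  1/n! k * fromℕ (k !) * (1/n! l * fromℕ (l !)) * (c * 1/n! n)
    ≡⟨ solve 6 (λ p k! q l! c r → (p :* k!) :* (q :* l!) :* (c :* r)
                               := (p :* q) :* (r :* (c :* (k! :* l!))))
         refl (1/n! k) (fromℕ (k !)) (1/n! l) (fromℕ (l !)) c (1/n! n) ⟩
  1/n! k * 1/n! l * (1/n! n * (c * (fromℕ (k !) * fromℕ (l !))))
    ≡⟨ cong (λ z → 1/n! k * 1/n! l * (1/n! n * z)) factorials ⟩
  1/n! k * 1/n! l * (1/n! n * fromℕ (n !))
    ≡⟨ cong (1/n! k * 1/n! l *_) (1/n!*n! n) ⟩
  1/n! k * 1/n! l * 1ℚ
    ≡⟨ ℚ.*-identityʳ (1/n! k * 1/n! l) ⟩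
  1/n! k * 1/n! l  ∎
  where
  l = n ∸ k
  c = fromℕ (n C k)
  instance _ = ℕ._!*_!≢0 k l
  factorials : c * (fromℕ (k !) * fromℕ (l !)) ≡ fromℕ (n !)
  factorials = begin
    c * (fromℕ (k !) * fromℕ (l !))  ≡⟨ cong (c *_) (fromℕ-* (k !) (l !)) ⟨
    c * fromℕ (k ! ℕ.* l !)          ≡⟨ fromℕ-* (n C k) (k ! ℕ.* l !) ⟨
    fromℕ ((n C k) ℕ.* (k ! ℕ.* l !))  ≡⟨ cong (λ z → fromℕ (z ℕ.* (k ! ℕ.* l !))) (nCk≡n!/k![n-k]! k≤n) ⟩
    fromℕ ((n ! ℕ./ (k ! ℕ.* l !)) ℕ.* (k ! ℕ.* l !))  ≡⟨ cong fromℕ (m/n*n≡m (k![n∸k]!∣n! k≤n)) ⟩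
    fromℕ (n !)                      ∎

-- Exponential series and the substitution of c x for x.

-- Coefficientwise this is the binomial theorem divided by n!.
exp-+ : ∀ a b → exp a ⊛ exp b ≗ exp (a + b)
exp-+ a b n = begin
  ∑[ i ≤ n ] (a ^ toℕ i * 1/n! (toℕ i) * (b ^ (n ∸ toℕ i) * 1/n! (n ∸ toℕ i)))
    ≡⟨ sum-cong-≗ {suc n} term ⟩
  ∑[ i ≤ n ] (Binomial.binomialTerm a b n i * 1/n! n)
    ≡⟨ *-distribʳ-sum {suc n} (1/n! n) (Binomial.binomialTerm a b n) ⟨
  Binomial.binomialExpansion a b n * 1/n! n
    ≡⟨ cong (_* 1/n! n) (Binomial.theorem n a b) ⟨
  (a + b) ^ n * 1/n! n  ∎
  where
  term : (i : Fin (suc n)) → a ^ toℕ i * 1/n! (toℕ i) * (b ^ (n ∸ toℕ i) * 1/n! (n ∸ toℕ i))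
                           ≡ Binomial.binomialTerm a b n i * 1/n! n
  term i = begin
    p * 1/n! k * (q * 1/n! (n ∸ k))
      ≡⟨ solve 4 (λ p r q s → p :* r :* (q :* s) := p :* q :* (r :* s)) refl p (1/n! k) q (1/n! (n ∸ k)) ⟩
    p * q * (1/n! k * 1/n! (n ∸ k))
      ≡⟨ cong (p * q *_) (nCk/n! (Fin.toℕ≤pred[n] i)) ⟨
    p * q * (fromℕ (n C k) * 1/n! n)
      ≡⟨ solve 3 (λ t c r → t :* (c :* r) := c :* t :* r) refl (p * q) (fromℕ (n C k)) (1/n! n) ⟩
    fromℕ (n C k) * (p * q) * 1/n! n
      ≡⟨ cong (_* 1/n! n) (×≡fromℕ* (n C k) (p * q)) ⟨
    (n C k) × (p * q) * 1/n! n  ∎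
    where
    k = toℕ i
    p = a ^ k
    q = b ^ (n ∸ k)

1^n≡1 : ∀ n → 1ℚ ^ n ≡ 1ℚ
1^n≡1 zero    = refl
1^n≡1 (suc n) = trans (ℚ.*-identityˡ (1ℚ ^ n)) (1^n≡1 n)

exp-0 : exp 0ℚ ≗ const 1ℚ
exp-0 zero    = refl
exp-0 (suc n) = begin
  0ℚ * 0ℚ ^ n * 1/n! (suc n)  ≡⟨ solve 2 (λ a b → con 0ℚ :* a :* b := con 0ℚ) refl (0ℚ ^ n) (1/n! (suc n)) ⟩
  0ℚ                          ∎

-- The series f(c x).
rescale : ℚ → Series → Series
rescale c f n = c ^ n * f n

-- Each term of the convolution has total degree `n`, so `c ^ n` splits between its two factors.
-- This carries the defining equation of the Bernoulli numbers from x to c x.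
rescale-⊛ : ∀ c f g → rescale c (f ⊛ g) ≗ rescale c f ⊛ rescale c g
rescale-⊛ c f g n = begin
  c ^ n * (f ⊛ g) n
    ≡⟨ *-distribˡ-sum {suc n} (c ^ n) (λ i → f (toℕ i) * g (n ∸ toℕ i)) ⟩
  ∑[ i ≤ n ] (c ^ n * (f (toℕ i) * g (n ∸ toℕ i)))
    ≡⟨ sum-cong-≗ {suc n} term ⟩
  (rescale c f ⊛ rescale c g) n  ∎
  where
  term : (i : Fin (suc n)) → c ^ n * (f (toℕ i) * g (n ∸ toℕ i))
                           ≡ rescale c f (toℕ i) * rescale c g (n ∸ toℕ i)
  term i = begin
    c ^ n * (f k * g l)
      ≡⟨ cong (λ m → c ^ m * (f k * g l)) (ℕ.m+[n∸m]≡n (Fin.toℕ≤pred[n] i)) ⟨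
    c ^ (k ℕ.+ l) * (f k * g l)
      ≡⟨ cong (_* (f k * g l)) (^-homo-* c k l) ⟩
    c ^ k * c ^ l * (f k * g l)
      ≡⟨ solve 4 (λ p q a b → p :* q :* (a :* b) := p :* a :* (q :* b)) refl (c ^ k) (c ^ l) (f k) (g l) ⟩
    c ^ k * f k * (c ^ l * g l)  ∎
    where
    k = toℕ i
    l = n ∸ k

rescale-X : ∀ c → rescale c X ≗ const c ⊛ X
rescale-X c zero          = trans (ℚ.*-zeroʳ 1ℚ) (sym (trans (const-⊛ c X 0) (ℚ.*-zeroʳ c)))
rescale-X c (suc zero)    = trans (cong (_* 1ℚ) (ℚ.*-identityʳ c)) (sym (const-⊛ c X 1))
rescale-X c (suc (suc n)) = trans (ℚ.*-zeroʳ (c ^ suc (suc n)))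
  (sym (trans (const-⊛ c X (suc (suc n))) (ℚ.*-zeroʳ c)))

rescale-exp⊝1 : ∀ c → rescale c (exp 1ℚ ⊝ const 1ℚ) ≗ exp c ⊝ const 1ℚ
rescale-exp⊝1 c zero    = refl
rescale-exp⊝1 c (suc n) = begin
  c ^ suc n * (1ℚ ^ suc n * 1/n! (suc n) - 0ℚ)
    ≡⟨ cong (λ z → c ^ suc n * (z * 1/n! (suc n) - 0ℚ)) (1^n≡1 (suc n)) ⟩
  c ^ suc n * (1ℚ * 1/n! (suc n) - 0ℚ)
    ≡⟨ solve 2 (λ p r → p :* (con 1ℚ :* r :- con 0ℚ) := p :* r :- con 0ℚ) refl (c ^ suc n) (1/n! (suc n)) ⟩
  c ^ suc n * 1/n! (suc n) - 0ℚ  ∎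

-- The functional equation between the two generating functions.

-- Here `u`, `v`, `w` stand for eˣ, e⁻ˣ, e²ˣ and `e`, `b₂`, `b₄` for s, b(2x), b(4x). Only the
-- listed relations matter, so the variables are arbitrary series and the rest is ring algebra.
sinh-bernoulli-cleared : ∀ x e u v w b₂ b₄ →
  u ⊛ u ≗ w → u ⊛ v ≗ const 1ℚ →
  e ⊛ (u ⊕ v) ≗ const (fromℕ 2) →
  b₂ ⊛ (w ⊝ const 1ℚ) ≗ const (fromℕ 2) ⊛ x →
  b₄ ⊛ (w ⊛ w ⊝ const 1ℚ) ≗ const (fromℕ 4) ⊛ x →
  x ⊛ (e ⊛ (u ⊝ v)) ⊛ (w ⊛ w ⊝ const 1ℚ) ≗
  const (fromℕ 2) ⊛ (x ⊝ b₂ ⊕ b₄) ⊛ (w ⊛ w ⊝ const 1ℚ)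
sinh-bernoulli-cleared x e u v w b₂ b₄ u²≗w uv≗1 e-eq b₂-eq b₄-eq = R.begin
  x ⊛ (e ⊛ (u ⊝ v)) ⊛ (w ⊛ w ⊝ 𝟙)
    R.≈⟨ S.solve 5 (λ x e u v w →
           x S.:* (e S.:* (u S.:- v)) S.:* (w S.:* w S.:- I)
           S.:= x S.:* (u S.:- v) S.:* (w S.:- I) S.:* (e S.:* (w S.:+ I)))
           (λ _ → refl) x e u v w ⟩
  x ⊛ (u ⊝ v) ⊛ (w ⊝ 𝟙) ⊛ (e ⊛ (w ⊕ 𝟙))
    -- Replacing w + 1 by u² + uv = u(u + v) frees a factor `u`. Joined to u - v it gives u² - uv =
    -- w - 1, and what remains is e(u + v) = 2.
    R.≈⟨ *-congˡ {x ⊛ (u ⊝ v) ⊛ (w ⊝ 𝟙)} (*-congˡ {e} (+-cong u²≗w uv≗1)) ⟨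
  x ⊛ (u ⊝ v) ⊛ (w ⊝ 𝟙) ⊛ (e ⊛ (u ⊛ u ⊕ u ⊛ v))
    R.≈⟨ S.solve 5 (λ x e u v w →
           x S.:* (u S.:- v) S.:* (w S.:- I) S.:* (e S.:* (u S.:* u S.:+ u S.:* v))
           S.:= x S.:* (w S.:- I) S.:* (u S.:* u S.:- u S.:* v) S.:* (e S.:* (u S.:+ v)))
           (λ _ → refl) x e u v w ⟩
  x ⊛ (w ⊝ 𝟙) ⊛ (u ⊛ u ⊝ u ⊛ v) ⊛ (e ⊛ (u ⊕ v))
    R.≈⟨ ⊛-cong (*-congˡ {x ⊛ (w ⊝ 𝟙)} (⊝-cong u²≗w uv≗1)) e-eq ⟩
  x ⊛ (w ⊝ 𝟙) ⊛ (w ⊝ 𝟙) ⊛ 𝟚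
    -- (w - 1)² = (w² - 1) - 2(w + 1) + 4. After multiplication by `x`, the equations for `b₂` and
    -- `b₄` exhibit w² - 1 in each of the three terms.
    R.≈⟨ S.solve 2 (λ x w →
           x S.:* (w S.:- I) S.:* (w S.:- I) S.:* II
           S.:= II S.:* (x S.:* (w S.:* w S.:- I) S.:- II S.:* x S.:* (w S.:+ I) S.:+ IV S.:* x))
           (λ _ → refl) x w ⟩
  𝟚 ⊛ (x ⊛ (w ⊛ w ⊝ 𝟙) ⊝ 𝟚 ⊛ x ⊛ (w ⊕ 𝟙) ⊕ 𝟜 ⊛ x)
    R.≈⟨ *-congˡ {𝟚} (+-cong (⊝-cong {x ⊛ (w ⊛ w ⊝ 𝟙)} (λ _ → refl) (*-congʳ {w ⊕ 𝟙} b₂-eq)) b₄-eq) ⟨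
  𝟚 ⊛ (x ⊛ (w ⊛ w ⊝ 𝟙) ⊝ b₂ ⊛ (w ⊝ 𝟙) ⊛ (w ⊕ 𝟙) ⊕ b₄ ⊛ (w ⊛ w ⊝ 𝟙))
    R.≈⟨ S.solve 4 (λ x w b₂ b₄ →
           II S.:* (x S.:* (w S.:* w S.:- I) S.:- b₂ S.:* (w S.:- I) S.:* (w S.:+ I)
                    S.:+ b₄ S.:* (w S.:* w S.:- I))
           S.:= II S.:* (x S.:- b₂ S.:+ b₄) S.:* (w S.:* w S.:- I))
           (λ _ → refl) x w b₂ b₄ ⟩
  𝟚 ⊛ (x ⊝ b₂ ⊕ b₄) ⊛ (w ⊛ w ⊝ 𝟙)  R.∎
  where
  import Relation.Binary.Reasoning.Setoid (CommutativeRing.setoid seriesRing) as R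
  open CommutativeRing seriesRing using (*-congˡ; *-congʳ; +-cong)
  𝟙 = const 1ℚ
  𝟚 = const (fromℕ 2)
  𝟜 = const (fromℕ 4)
  I : ∀ {n} → S.Polynomial n
  I = S.con 1ℚ
  II : ∀ {n} → S.Polynomial n
  II = S.con (fromℕ 2)
  IV : ∀ {n} → S.Polynomial n
  IV = S.con (fromℕ 4)
  ⊝-cong : ∀ {f f′ g g′} → f ≗ f′ → g ≗ g′ → f ⊝ g ≗ f′ ⊝ g′
  ⊝-cong f≗f′ g≗g′ n = cong₂ _-_ (f≗f′ n) (g≗g′ n)

sinh-bernoulli : ∀ B E → IsBernoulli B → IsEuler E →
  X ⊛ (egf E ⊛ (exp 1ℚ ⊝ exp (- 1ℚ))) ≗
  const (fromℕ 2) ⊛ (X ⊝ rescale (fromℕ 2) (egf B) ⊕ rescale (fromℕ 4) (egf B))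
-- The cancelled series e⁴ˣ - 1 has constant coefficient 0 and linear coefficient 4, both by
-- computation.
sinh-bernoulli B E isB isE = ⊛-cancelʳ₁ (exp 4ℚ ⊝ 𝟙) refl {{_}} _ _ λ n → begin
  (X ⊛ (egf E ⊛ (exp 1ℚ ⊝ exp (- 1ℚ))) ⊛ (exp 4ℚ ⊝ 𝟙)) n
    ≡⟨ *-congˡ {X ⊛ (egf E ⊛ (exp 1ℚ ⊝ exp (- 1ℚ)))} w²⊝1 n ⟨
  (X ⊛ (egf E ⊛ (exp 1ℚ ⊝ exp (- 1ℚ))) ⊛ (w ⊛ w ⊝ 𝟙)) n
    ≡⟨ sinh-bernoulli-cleared X (egf E) (exp 1ℚ) (exp (- 1ℚ)) w (b 2ℚ) (b 4ℚ)
         (exp-+ 1ℚ 1ℚ) (λ k → trans (exp-+ 1ℚ (- 1ℚ) k) (exp-0 k)) isE (b-eq 2ℚ)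
         (λ k → trans (*-congˡ {b 4ℚ} w²⊝1 k) (b-eq 4ℚ k)) n ⟩
  (𝟚 ⊛ (X ⊝ b 2ℚ ⊕ b 4ℚ) ⊛ (w ⊛ w ⊝ 𝟙)) n
    ≡⟨ *-congˡ {𝟚 ⊛ (X ⊝ b 2ℚ ⊕ b 4ℚ)} w²⊝1 n ⟩
  (𝟚 ⊛ (X ⊝ b 2ℚ ⊕ b 4ℚ) ⊛ (exp 4ℚ ⊝ 𝟙)) n  ∎
  where
  open CommutativeRing seriesRing using (*-congˡ)
  2ℚ = fromℕ 2
  4ℚ = fromℕ 4
  𝟙 = const 1ℚ
  𝟚 = const 2ℚ
  w = exp 2ℚ
  b : ℚ → Series
  b c = rescale c (egf B)
  -- The defining equation of `B` with c x substituted for x.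
  b-eq : ∀ c → b c ⊛ (exp c ⊝ 𝟙) ≗ const c ⊛ X
  b-eq c n = begin
    (b c ⊛ (exp c ⊝ 𝟙)) n                   ≡⟨ *-congˡ {b c} (rescale-exp⊝1 c) n ⟨
    (b c ⊛ rescale c (exp 1ℚ ⊝ 𝟙)) n        ≡⟨ rescale-⊛ c (egf B) (exp 1ℚ ⊝ 𝟙) n ⟨
    c ^ n * (egf B ⊛ (exp 1ℚ ⊝ 𝟙)) n        ≡⟨ cong (c ^ n *_) (isB n) ⟩
    rescale c X n                           ≡⟨ rescale-X c n ⟩
    (const c ⊛ X) n                         ∎
  w²⊝1 : w ⊛ w ⊝ 𝟙 ≗ exp 4ℚ ⊝ 𝟙
  w²⊝1 n = cong (_- 𝟙 n) (exp-+ 2ℚ 2ℚ n)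

-- Coefficients of products with x and with 2 sinh x.

X-⊛ : ∀ f n → (X ⊛ f) (suc n) ≡ f n
X-⊛ f n = begin
  0ℚ * f (suc n) + (tail X ⊛ f) n     ≡⟨ cong (0ℚ * f (suc n) +_) (⊛-cong {g = f} tail-X (λ _ → refl) n) ⟩
  0ℚ * f (suc n) + (const 1ℚ ⊛ f) n   ≡⟨ cong (0ℚ * f (suc n) +_) (⊛-identityˡ f n) ⟩
  0ℚ * f (suc n) + f n                ≡⟨ solve 2 (λ a b → con 0ℚ :* a :+ b := b) refl (f (suc n)) (f n) ⟩
  f n                                 ∎
  where
  tail-X : tail X ≗ const 1ℚ
  tail-X zero    = refl
  tail-X (suc n) = refl

-- Pairing neighbouring terms isolates the even indices, so that the odd half of a convolution can
-- be discarded.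
∑-even-odd : ∀ n (f : ℕ → ℚ) →
  ∑[ i < 2 ℕ.* n ] f (toℕ i) ≡ ∑[ j < n ] (f (2 ℕ.* toℕ j) + f (suc (2 ℕ.* toℕ j)))
∑-even-odd zero    f = refl
∑-even-odd (suc n) f = begin
  ∑[ i < 2 ℕ.* suc n ] f (toℕ i)
    ≡⟨ cong (λ k → ∑[ i < k ] f (toℕ i)) (ℕ.*-suc 2 n) ⟩
  f 0 + (f 1 + ∑[ i < 2 ℕ.* n ] f (2 ℕ.+ toℕ i))
    ≡⟨ ℚ.+-assoc (f 0) (f 1) _ ⟨
  f 0 + f 1 + ∑[ i < 2 ℕ.* n ] f (2 ℕ.+ toℕ i)
    ≡⟨ cong (f 0 + f 1 +_) (∑-even-odd n (λ k → f (2 ℕ.+ k))) ⟩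
  f 0 + f 1 + ∑[ j < n ] (f (2 ℕ.+ 2 ℕ.* toℕ j) + f (3 ℕ.+ 2 ℕ.* toℕ j))
    ≡⟨ cong (f 0 + f 1 +_) (sum-cong-≗ {n} λ j → cong (λ k → f k + f (suc k)) (ℕ.*-suc 2 (toℕ j))) ⟨
  f 0 + f 1 + ∑[ j < n ] (f (2 ℕ.* suc (toℕ j)) + f (suc (2 ℕ.* suc (toℕ j))))  ∎

[-1]^2n≡1 : ∀ n → (- 1ℚ) ^ (2 ℕ.* n) ≡ 1ℚ
-- The power regroups as ((-1)²)ⁿ, and (-1)² computes to `1ℚ`.
[-1]^2n≡1 n = trans (sym (^-assocʳ (- 1ℚ) 2 n)) (1^n≡1 n)

2sinh-even : ∀ n → (exp 1ℚ ⊝ exp (- 1ℚ)) (2 ℕ.* n) ≡ 0ℚ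
2sinh-even n = begin
  1ℚ ^ (2 ℕ.* n) * r - (- 1ℚ) ^ (2 ℕ.* n) * r  ≡⟨ cong₂ (λ a b → a * r - b * r) (1^n≡1 (2 ℕ.* n)) ([-1]^2n≡1 n) ⟩
  1ℚ * r - 1ℚ * r                              ≡⟨ ℚ.+-inverseʳ (1ℚ * r) ⟩
  0ℚ                                           ∎
  where r = 1/n! (2 ℕ.* n)

2sinh-odd : ∀ n → (exp 1ℚ ⊝ exp (- 1ℚ)) (suc (2 ℕ.* n)) ≡ fromℕ 2 * 1/n! (suc (2 ℕ.* n))
2sinh-odd n = begin
  1ℚ ^ suc (2 ℕ.* n) * r - (- 1ℚ) * (- 1ℚ) ^ (2 ℕ.* n) * r
    ≡⟨ cong₂ (λ a b → a * r - (- 1ℚ) * b * r) (1^n≡1 (suc (2 ℕ.* n))) ([-1]^2n≡1 n) ⟩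
  1ℚ * r - (- 1ℚ) * 1ℚ * r
    ≡⟨ solve 1 (λ r → con 1ℚ :* r :- (:- con 1ℚ) :* con 1ℚ :* r := con (fromℕ 2) :* r) refl r ⟩
  fromℕ 2 * r  ∎
  where r = 1/n! (suc (2 ℕ.* n))

-- In odd total degree an odd index of `f` faces an even index of 2 sinh x, where the coefficient is
-- zero; an even index faces an odd one, where it is 2 over a factorial.
⊛-2sinh : ∀ f n → (f ⊛ (exp 1ℚ ⊝ exp (- 1ℚ))) (suc (2 ℕ.* n)) ≡
  fromℕ 2 * ∑[ j < suc n ] (f (2 ℕ.* toℕ j) * 1/n! (suc (2 ℕ.* n) ∸ 2 ℕ.* toℕ j))
⊛-2sinh f n = begin
  ∑[ i ≤ M ] F (toℕ i)
    -- The sum up to `M` has 2n + 2 terms, hence exactly n + 1 pairs.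
    ≡⟨ cong (λ k → ∑[ i < k ] F (toℕ i)) (ℕ.*-suc 2 n) ⟨
  ∑[ i < 2 ℕ.* suc n ] F (toℕ i)
    ≡⟨ ∑-even-odd (suc n) F ⟩
  ∑[ j ≤ n ] (F (2 ℕ.* toℕ j) + F (suc (2 ℕ.* toℕ j)))
    ≡⟨ sum-cong-≗ {suc n} (λ j → pair (Fin.toℕ≤pred[n] j)) ⟩
  ∑[ j ≤ n ] (fromℕ 2 * (f (2 ℕ.* toℕ j) * 1/n! (M ∸ 2 ℕ.* toℕ j)))
    ≡⟨ *-distribˡ-sum {suc n} (fromℕ 2) (λ j → f (2 ℕ.* toℕ j) * 1/n! (M ∸ 2 ℕ.* toℕ j)) ⟨
  fromℕ 2 * ∑[ j ≤ n ] (f (2 ℕ.* toℕ j) * 1/n! (M ∸ 2 ℕ.* toℕ j))  ∎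
  where
  M = suc (2 ℕ.* n)
  s = exp 1ℚ ⊝ exp (- 1ℚ)
  F : ℕ → ℚ
  F k = f k * s (M ∸ k)
  pair : ∀ {j} → j ≤ n → F (2 ℕ.* j) + F (suc (2 ℕ.* j)) ≡ fromℕ 2 * (f (2 ℕ.* j) * 1/n! (M ∸ 2 ℕ.* j))
  pair {j} j≤n = begin
    f (2 ℕ.* j) * s (M ∸ 2 ℕ.* j) + f (suc (2 ℕ.* j)) * s (2 ℕ.* n ∸ 2 ℕ.* j)
      ≡⟨ cong₂ (λ k l → f (2 ℕ.* j) * s k + f (suc (2 ℕ.* j)) * s l) odd even ⟩
    f (2 ℕ.* j) * s (suc (2 ℕ.* (n ∸ j))) + f (suc (2 ℕ.* j)) * s (2 ℕ.* (n ∸ j))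
      ≡⟨ cong₂ (λ p q → f (2 ℕ.* j) * p + f (suc (2 ℕ.* j)) * q) (2sinh-odd (n ∸ j)) (2sinh-even (n ∸ j)) ⟩
    f (2 ℕ.* j) * (fromℕ 2 * 1/n! (suc (2 ℕ.* (n ∸ j)))) + f (suc (2 ℕ.* j)) * 0ℚ
      ≡⟨ solve 3 (λ a b r → a :* (con (fromℕ 2) :* r) :+ b :* con 0ℚ := con (fromℕ 2) :* (a :* r))
           refl (f (2 ℕ.* j)) (f (suc (2 ℕ.* j))) (1/n! (suc (2 ℕ.* (n ∸ j)))) ⟩
    fromℕ 2 * (f (2 ℕ.* j) * 1/n! (suc (2 ℕ.* (n ∸ j))))
      ≡⟨ cong (λ k → fromℕ 2 * (f (2 ℕ.* j) * 1/n! k)) odd ⟨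
    fromℕ 2 * (f (2 ℕ.* j) * 1/n! (M ∸ 2 ℕ.* j))  ∎
    where
    even : 2 ℕ.* n ∸ 2 ℕ.* j ≡ 2 ℕ.* (n ∸ j)
    even = sym (ℕ.*-distribˡ-∸ 2 n j)
    odd : M ∸ 2 ℕ.* j ≡ suc (2 ℕ.* (n ∸ j))
    odd = trans (ℕ.+-∸-assoc 1 (ℕ.*-monoʳ-≤ 2 j≤n)) (cong suc even)

-- Numerical factors of the final formula.

1/n!-suc : ∀ n → 1/n! n ≡ fromℕ (suc n) * 1/n! (suc n)
1/n!-suc n = begin
  1/n! n
    ≡⟨ ℚ.*-identityʳ (1/n! n) ⟨
  1/n! n * 1ℚ
    ≡⟨ cong (1/n! n *_) (1/n!*n! (suc n)) ⟨
  1/n! n * (1/n! (suc n) * fromℕ (suc n !))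
    ≡⟨ cong (λ z → 1/n! n * (1/n! (suc n) * z)) (fromℕ-* (suc n) (n !)) ⟩
  1/n! n * (1/n! (suc n) * (fromℕ (suc n) * fromℕ (n !)))
    ≡⟨ solve 4 (λ r s m n! → r :* (s :* (m :* n!)) := m :* s :* (r :* n!))
         refl (1/n! n) (1/n! (suc n)) (fromℕ (suc n)) (fromℕ (n !)) ⟩
  fromℕ (suc n) * 1/n! (suc n) * (1/n! n * fromℕ (n !))
    ≡⟨ cong (fromℕ (suc n) * 1/n! (suc n) *_) (1/n!*n! n) ⟩
  fromℕ (suc n) * 1/n! (suc n) * 1ℚ
    ≡⟨ ℚ.*-identityʳ _ ⟩
  fromℕ (suc n) * 1/n! (suc n)  ∎

fromℕ-m[m∸1] : ∀ m .{{_ : NonZero m}} → fromℕ (m ℕ.* (m ∸ 1)) ≡ fromℕ m * fromℕ m - fromℕ m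
fromℕ-m[m∸1] m@(suc k) = begin
  fromℕ (m ℕ.* k)              ≡⟨ fromℕ-* m k ⟩
  fromℕ m * fromℕ k            ≡⟨ solve 2 (λ m k → m :* k := m :* (con 1ℚ :+ k) :- m) refl (fromℕ m) (fromℕ k) ⟩
  fromℕ m * (1ℚ + fromℕ k) - fromℕ m  ≡⟨ cong (λ z → fromℕ m * z - fromℕ m) (fromℕ-+ 1 k) ⟨
  fromℕ m * fromℕ m - fromℕ m  ∎

-- Since 4ⁿ = 2ⁿ · 2ⁿ, the denominator in the theorem is the factor that b(4x) - b(2x) puts before a
-- coefficient of b.
fromℕ-2^n[2^n∸1] : ∀ n → fromℕ (2 ℕ.^ n ℕ.* (2 ℕ.^ n ∸ 1)) ≡ fromℕ 4 ^ n - fromℕ 2 ^ n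
fromℕ-2^n[2^n∸1] n = begin
  fromℕ (2 ℕ.^ n ℕ.* (2 ℕ.^ n ∸ 1))
    ≡⟨ fromℕ-m[m∸1] (2 ℕ.^ n) {{ℕ.m^n≢0 2 n}} ⟩
  fromℕ (2 ℕ.^ n) * fromℕ (2 ℕ.^ n) - fromℕ (2 ℕ.^ n)
    ≡⟨ cong (λ z → z * z - z) (fromℕ-^ 2 n) ⟩
  fromℕ 2 ^ n * fromℕ 2 ^ n - fromℕ 2 ^ n
    ≡⟨ cong (_- fromℕ 2 ^ n) (^-distrib-* (fromℕ 2) (fromℕ 2) n) ⟨
  fromℕ 4 ^ n - fromℕ 2 ^ n  ∎

-- The inverse is an explicit argument because each use has one at hand: N!/2 for 2/N!, and 1/d for
-- `d`.
*-cancelʳ-invertible : ∀ {p q} r s → r * s ≡ 1ℚ → p * r ≡ q * r → p ≡ q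
*-cancelʳ-invertible {p} {q} r s rs≡1 pr≡qr = begin
  p            ≡⟨ ℚ.*-identityʳ p ⟨
  p * 1ℚ       ≡⟨ cong (p *_) rs≡1 ⟨
  p * (r * s)  ≡⟨ ℚ.*-assoc p r s ⟨
  p * r * s    ≡⟨ cong (_* s) pr≡qr ⟩
  q * r * s    ≡⟨ ℚ.*-assoc q r s ⟩
  q * (r * s)  ≡⟨ cong (q *_) rs≡1 ⟩
  q * 1ℚ       ≡⟨ ℚ.*-identityʳ q ⟩
  q            ∎

-- Comparison of the coefficients of x to the power 2n + 2.

module _ (B E : ℕ → ℚ) (isB : IsBernoulli B) (isE : IsEuler E) where

  -- The sum of the theorem with its index shifted by one: `suc (2 ℕ.* n)` is 2(n + 1) - 1 without
  -- truncated subtraction.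
  eulerSum : ℕ → ℚ
  eulerSum n = ∑[ j ≤ n ] (fromℕ (suc (2 ℕ.* n) C (2 ℕ.* toℕ j)) * E (2 ℕ.* toℕ j))

  eulerSum/n! : ∀ n → ∑[ j ≤ n ] (egf E (2 ℕ.* toℕ j) * 1/n! (suc (2 ℕ.* n) ∸ 2 ℕ.* toℕ j))
                    ≡ eulerSum n * 1/n! (suc (2 ℕ.* n))
  eulerSum/n! n = trans
    (sum-cong-≗ {suc n} λ j → term (2 ℕ.* toℕ j)
      (ℕ.m≤n⇒m≤1+n (ℕ.*-monoʳ-≤ 2 (Fin.toℕ≤pred[n] j))))
    (sym (*-distribʳ-sum {suc n} (1/n! M) (λ j → fromℕ (M C (2 ℕ.* toℕ j)) * E (2 ℕ.* toℕ j))))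
    where
    M = suc (2 ℕ.* n)
    term : ∀ k → k ≤ M → E k * 1/n! k * 1/n! (M ∸ k) ≡ fromℕ (M C k) * E k * 1/n! M
    term k k≤M = begin
      E k * 1/n! k * 1/n! (M ∸ k)      ≡⟨ ℚ.*-assoc (E k) (1/n! k) (1/n! (M ∸ k)) ⟩
      E k * (1/n! k * 1/n! (M ∸ k))    ≡⟨ cong (E k *_) (nCk/n! k≤M) ⟨
      E k * (fromℕ (M C k) * 1/n! M)   ≡⟨ solve 3 (λ e c r → e :* (c :* r) := c :* e :* r)
                                            refl (E k) (fromℕ (M C k)) (1/n! M) ⟩
      fromℕ (M C k) * E k * 1/n! M     ∎

  bernoulli-eulerSum : ∀ n → let N = 2 ℕ.+ 2 ℕ.* n in
    B N * fromℕ (2 ℕ.^ N ℕ.* (2 ℕ.^ N ∸ 1)) ≡ fromℕ N * eulerSum n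
  bernoulli-eulerSum n =
    -- Both sides of the functional equation carry 2/N! in degree `N`.
    *-cancelʳ-invertible (fromℕ 2 * r) (fromℕ (N !) * ½) 2/N!-invertible (begin
      B N * fromℕ (2 ℕ.^ N ℕ.* (2 ℕ.^ N ∸ 1)) * (fromℕ 2 * r)
        ≡⟨ cong (λ z → B N * z * (fromℕ 2 * r)) (fromℕ-2^n[2^n∸1] N) ⟩
      B N * (fromℕ 4 ^ N - fromℕ 2 ^ N) * (fromℕ 2 * r)
        -- The `con 0ℚ` is `X N`, which vanishes because `N` is at least 2.
        ≡⟨ solve 4 (λ b p q r → b :* (q :- p) :* (con (fromℕ 2) :* r)
                      := con (fromℕ 2) :* (con 0ℚ :- p :* (b :* r) :+ q :* (b :* r)))
             refl (B N) (fromℕ 2 ^ N) (fromℕ 4 ^ N) r ⟩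
      fromℕ 2 * (X ⊝ rescale (fromℕ 2) (egf B) ⊕ rescale (fromℕ 4) (egf B)) N
        ≡⟨ const-⊛ (fromℕ 2) (X ⊝ rescale (fromℕ 2) (egf B) ⊕ rescale (fromℕ 4) (egf B)) N ⟨
      (const (fromℕ 2) ⊛ (X ⊝ rescale (fromℕ 2) (egf B) ⊕ rescale (fromℕ 4) (egf B))) N
        ≡⟨ sinh-bernoulli B E isB isE N ⟨
      (X ⊛ (egf E ⊛ (exp 1ℚ ⊝ exp (- 1ℚ)))) N
        ≡⟨ X-⊛ (egf E ⊛ (exp 1ℚ ⊝ exp (- 1ℚ))) M ⟩
      (egf E ⊛ (exp 1ℚ ⊝ exp (- 1ℚ))) M
        ≡⟨ ⊛-2sinh (egf E) n ⟩
      fromℕ 2 * ∑[ j ≤ n ] (egf E (2 ℕ.* toℕ j) * 1/n! (M ∸ 2 ℕ.* toℕ j))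
        ≡⟨ cong (fromℕ 2 *_) (eulerSum/n! n) ⟩
      fromℕ 2 * (eulerSum n * 1/n! M)
        -- The factor x lowers the degree on the Euler side to `M`; passing from 1/M! to 1/N!
        -- produces the factor 2n of the theorem.
        ≡⟨ cong (λ z → fromℕ 2 * (eulerSum n * z)) (1/n!-suc M) ⟩
      fromℕ 2 * (eulerSum n * (fromℕ N * r))
        ≡⟨ solve 3 (λ s m r → con (fromℕ 2) :* (s :* (m :* r)) := m :* s :* (con (fromℕ 2) :* r))
             refl (eulerSum n) (fromℕ N) r ⟩
      fromℕ N * eulerSum n * (fromℕ 2 * r)  ∎)
    where
    M = suc (2 ℕ.* n)
    N = suc M
    r = 1/n! N
    2/N!-invertible : fromℕ 2 * r * (fromℕ (N !) * ½) ≡ 1ℚ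
    2/N!-invertible = trans
      (solve 2 (λ r m → con (fromℕ 2) :* r :* (m :* con ½) := r :* m) refl r (fromℕ (N !)))
      (1/n!*n! N)

open import Data.Integer.Base using (+_)

theorem1p3 : (B E : ℕ → ℚ) → IsBernoulli B → IsEuler E →
    (n : ℕ) .{{_ : NonZero n}} →
    B (2 ℕ.* n) ≡
    _/_ (+ (2 ℕ.* n)) (2 ℕ.^ (2 ℕ.* n) ℕ.* (2 ℕ.^ (2 ℕ.* n) ∸ 1)) {{2^2n[2^2n∸1]≢0 n}}
    * (∑[ j < n ] ((+ ((2 ℕ.* n ∸ 1) C (2 ℕ.* toℕ j)) / 1) * E (2 ℕ.* toℕ j)))
theorem1p3 B E isB isE n@(suc m) =
  -- Multiplying by the denominator reduces the claim to `scaled`.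
  *-cancelʳ-invertible D D⁻¹ (trans (ℚ.*-comm D D⁻¹) (/-*-cancel 1 d)) (begin
    B N * D                   ≡⟨ scaled ⟩
    fromℕ N * S               ≡⟨ cong (_* S) (/-*-cancel N d) ⟨
    (+ N / d) * D * S         ≡⟨ solve 3 (λ q d s → q :* d :* s := q :* s :* d) refl (+ N / d) D S ⟩
    (+ N / d) * S * D         ∎)
  where
  N = 2 ℕ.* n
  d = 2 ℕ.^ N ℕ.* (2 ℕ.^ N ∸ 1)
  instance _ = 2^2n[2^2n∸1]≢0 n
  D = fromℕ d
  D⁻¹ = + 1 / d
  S = ∑[ j < n ] (fromℕ ((N ∸ 1) C (2 ℕ.* toℕ j)) * E (2 ℕ.* toℕ j))
  scaled : B N * D ≡ fromℕ N * S
  -- `2 ℕ.* suc m` equals `2 ℕ.+ 2 ℕ.* m` only propositionally, so every occurrence is transported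
  -- at once; at the latter value `k ∸ 1` computes to `suc (2 ℕ.* m)`, as in `eulerSum`.
  scaled = subst
    (λ k → B k * fromℕ (2 ℕ.^ k ℕ.* (2 ℕ.^ k ∸ 1)) ≡
           fromℕ k * ∑[ j < n ] (fromℕ ((k ∸ 1) C (2 ℕ.* toℕ j)) * E (2 ℕ.* toℕ j)))
    (sym (ℕ.*-suc 2 m)) (bernoulli-eulerSum B E isB isE m)
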